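{- Let $A$ be a finite alphabet. For all non-empty sentences $I,J$ over $A$, the coloured ribbon non-commutative Schur functions in $\mathrm{NSym}_A$ satisfy $$R_IR_J=R_{I\cdot J}+R_{I\odot J}.$$
   Context: $\Bbbk$ is a field of characteristic zero. A sentence $I=(w_1,\dots,w_m)$ over $A$ is a finite sequence of non-empty words in letters of $A$; $1$ is the empty sentence. The concatenation of $I=(w_1,\dots,w_m)$ and $J=(v_1,\dots,v_n)$ is $I\cdot J=(w_1,\dots,w_m,v_1,\dots,v_n)$, and the near-concatenation of non-empty sentences is $I\odot J=(w_1,\dots,w_{m-1},w_mv_1,v_2,\dots,v_n)$. Write $J\preccurlyeq I$ ($J$ refines $I$) if the words of $I$ can be obtained by concatenating adjacent words of $J$. $\mathrm{NSym}_A$ is the $\Bbbk$-algebra with linear basis $(H_I)$ indexed by sentences over $A$ and product $H_IH_J=H_{I\cdot J}$. It carries a Hopf algebra structure graded by the total number of letters; $\mathrm{QSym}_A$ is its graded dual, with basis $(M_I)$ dual to $(H_I)$: $\langle M_I,H_J\rangle=\delta_{I,J}$. The fundamental functions $F_I=\sum_{J\preccurlyeq I}M_J$ form a basis of $\mathrm{QSym}_A$, and $(R_I)$ is the basis of $\mathrm{NSym}_A$ dual to it: $\langle F_I,R_J\rangle=\delta_{I,J}$. -}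

module Defs where

open import Algebra.Apartness.Bundles using (HeytingField; HeytingCommutativeRing)
open import Algebra.Bundles using (CommutativeRing)
import Algebra.Definitions.RawMonoid as RawMonoidDefs
open import Data.Bool.Base using (if_then_else_)
open import Data.Empty using (⊥)
open import Data.Fin.Base using (Fin)
open import Data.Fin.Properties using (inj⇒≟)
open import Data.List.Base as List
  using (List; []; _∷_; _++_; map; foldr; cartesianProductWith)
open import Data.List.Membership.Propositional using (_∈_)
open import Data.List.Membership.Propositional.Properties
  using (∈-map⁺; ∈-map⁻; ∈-++⁺ˡ; ∈-++⁺ʳ; ∈-++⁻)
open import Data.List.NonEmpty.Base as List⁺
  using (List⁺; _∷_; toList; _∷⁺_; _⁺++⁺_)
open import Data.List.Properties using (≡-dec)
open import Data.List.Relation.Unary.All using ([])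
open import Data.List.Relation.Unary.AllPairs using ([]; _∷_)
open import Data.List.Relation.Unary.Any using (here)
open import Data.List.Relation.Unary.Unique.Propositional using (Unique)
import Data.List.Relation.Unary.Unique.Propositional.Properties as Unique
open import Data.Nat.Base using (ℕ; suc)
open import Data.Product.Base using (Σ-syntax; ∃-syntax; _×_; _,_)
open import Data.Sum.Base using (inj₁; inj₂)
open import Function.Bundles using (_↔_)
open import Function.Properties.Inverse using (↔⇒↣)
open import Level using (Level; _⊔_)
open import Relation.Binary.Definitions using (DecidableEquality)
open import Relation.Binary.PropositionalEquality using (_≡_; refl; cong)
open import Relation.Nullary.Decidable using (does; map′)
open import Relation.Nullary.Negation using (¬_)

private
  variable
    a p : Level

CharacteristicZero : ∀ {c ℓ₁ ℓ₂} → HeytingField c ℓ₁ ℓ₂ → Set ℓ₁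
CharacteristicZero K = ∀ (n : ℕ) → ¬ ((suc n ×′ 1#) ≈ 0#)
  where
  open HeytingField K
  open RawMonoidDefs
    (CommutativeRing.+-rawMonoid
      (HeytingCommutativeRing.commutativeRing heytingCommutativeRing))
    using () renaming (_×_ to _×′_)

module Sentences (A : Set a) where

  Word : Set a
  Word = List⁺ A

  Sentence : Set a
  Sentence = List Word

  NonEmptySentence : Set a
  NonEmptySentence = List⁺ Word

  infixr 5 _·_ _⊙_

  _·_ : Sentence → Sentence → Sentence
  _·_ = _++_

  nearConcat : Word → List Word → NonEmptySentence → NonEmptySentence
  nearConcat w []       (v ∷ vs) = (w ⁺++⁺ v) ∷ vs
  nearConcat w (u ∷ us) J        = w ∷⁺ nearConcat u us J

  _⊙_ : NonEmptySentence → NonEmptySentence → NonEmptySentence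
  (w ∷ ws) ⊙ J = nearConcat w ws J

  infix 4 _≼_

  -- G partitions J into non-empty blocks of adjacent words; the words of I are
  -- the concatenations of these blocks.
  _≼_ : Sentence → Sentence → Set a
  J ≼ I = ∃[ G ] List.concat (map toList G) ≡ J × map List⁺.concat G ≡ I

record Enumeration {X : Set a} (P : X → Set p) : Set (a ⊔ p) where
  field
    elements : List X
    unique   : Unique elements
    sound    : ∀ {x} → x ∈ elements → P x
    complete : ∀ {x} → P x → x ∈ elements

module Refinements (A : Set a) where
  open Sentences A

  glue : A → NonEmptySentence → NonEmptySentence
  glue x (w ∷ ws) = (x ∷⁺ w) ∷ ws

  split : A → NonEmptySentence → NonEmptySentence
  split x J = (x ∷ []) ∷⁺ J

  -- The refinements of the sentence (x ∷ xs) ∷ I.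
  refine : A → List A → Sentence → List NonEmptySentence
  refine x []       []             = ((x ∷ []) ∷ []) ∷ []
  refine x []       ((y ∷ ys) ∷ I) = map (split x) (refine y ys I)
  refine x (y ∷ ys) I              =
    map (split x) (refine y ys I) ++ map (glue x) (refine y ys I)

  split-injective : ∀ {x J K} → split x J ≡ split x K → J ≡ K
  split-injective refl = refl

  glue-injective : ∀ {x J K} → glue x J ≡ glue x K → J ≡ K
  glue-injective refl = refl

  split≢glue : ∀ {x J K} → split x J ≡ glue x K → ⊥
  split≢glue ()

  toList-injective : ∀ {J K : NonEmptySentence} → toList J ≡ toList K → J ≡ K
  toList-injective refl = refl

  ∈-map-toList : ∀ {L J} {Ls : List NonEmptySentence} →
                 L ∈ Ls → toList L ≡ J → J ∈ map toList Ls
  ∈-map-toList p refl = ∈-map⁺ toList p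

  refine-unique : ∀ x xs I → Unique (refine x xs I)
  refine-unique x []       []             = [] ∷ []
  refine-unique x []       ((y ∷ ys) ∷ I) =
    Unique.map⁺ split-injective (refine-unique y ys I)
  refine-unique x (y ∷ ys) I              =
    Unique.++⁺ (Unique.map⁺ split-injective (refine-unique y ys I))
               (Unique.map⁺ glue-injective (refine-unique y ys I))
               disjoint
    where
    disjoint : ∀ {L} → L ∈ map (split x) (refine y ys I)
                     × L ∈ map (glue x) (refine y ys I) → ⊥
    disjoint (p , q) with ∈-map⁻ (split x) p | ∈-map⁻ (glue x) q
    ... | _ , _ , refl | _ , _ , eq = split≢glue eq

  split-≼ : ∀ {x y ys I J} → toList J ≼ (y ∷ ys) ∷ I →
            toList (split x J) ≼ (x ∷ y ∷ ys) ∷ I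
  split-≼ {x} ((u ∷ us) ∷ G , refl , refl) =
    (((x ∷ []) ∷ u ∷ us) ∷ G) , refl , refl

  glue-≼ : ∀ {x y ys I J} → toList J ≼ (y ∷ ys) ∷ I →
           toList (glue x J) ≼ (x ∷ y ∷ ys) ∷ I
  glue-≼ {x} ((u ∷ us) ∷ G , refl , refl) =
    (((x ∷⁺ u) ∷ us) ∷ G) , refl , refl

  refine-sound : ∀ x xs I {J} → J ∈ refine x xs I → toList J ≼ (x ∷ xs) ∷ I
  refine-sound x []       []             (here refl) =
    (((x ∷ []) ∷ []) ∷ []) , refl , refl
  refine-sound x []       ((y ∷ ys) ∷ I) p
    with ∈-map⁻ (split x) p
  ... | J , q , refl with refine-sound y ys I q
  ... | G , eq′ , eq =
    (((x ∷ []) ∷ []) ∷ G) , cong ((x ∷ []) ∷_) eq′ , cong ((x ∷ []) ∷_) eq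
  refine-sound x (y ∷ ys) I p
    with ∈-++⁻ (map (split x) (refine y ys I)) p
  ... | inj₁ q with ∈-map⁻ (split x) q
  ...   | J , r , refl = split-≼ {J = J} (refine-sound y ys I r)
  refine-sound x (y ∷ ys) I p | inj₂ q with ∈-map⁻ (glue x) q
  ...   | J , r , refl = glue-≼ {J = J} (refine-sound y ys I r)

  refine-complete : ∀ x xs (us : List Word) (G : List (List⁺ Word)) →
    let g = (x ∷ xs) ∷ us in
    Σ[ L ∈ NonEmptySentence ]
      L ∈ refine x (xs ++ List.concat (map toList us)) (map List⁺.concat G) ×
      toList L ≡ List.concat (map toList (g ∷ G))
  refine-complete x [] [] [] = _ , here refl , refl
  refine-complete x [] [] (((y ∷ ys) ∷ us) ∷ G)
    with refine-complete y ys us G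
  ... | L , p , eq = split x L , ∈-map⁺ (split x) p , cong ((x ∷ []) ∷_) eq
  refine-complete x [] ((y ∷ ys) ∷ us) G
    with refine-complete y ys us G
  ... | L , p , eq =
    split x L , ∈-++⁺ˡ (∈-map⁺ (split x) p) , cong ((x ∷ []) ∷_) eq
  refine-complete x (y ∷ ys) us G
    with refine-complete y ys us G
  ... | L , p , refl =
    glue x L , ∈-++⁺ʳ (map (split x) _) (∈-map⁺ (glue x) p) , refl

  refinements : (I : Sentence) → Enumeration (_≼ I)
  refinements [] = record
    { elements = [] ∷ []
    ; unique   = [] ∷ []
    ; sound    = λ { (here refl) → [] , refl , refl }
    ; complete = λ { ([] , refl , refl) → here refl }
    }
  refinements ((x ∷ xs) ∷ I) = record
    { elements = map toList (refine x xs I)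
    ; unique   = Unique.map⁺ toList-injective (refine-unique x xs I)
    ; sound    = sound′
    ; complete = complete′
    }
    where
    sound′ : ∀ {J} → J ∈ map toList (refine x xs I) → J ≼ (x ∷ xs) ∷ I
    sound′ p with ∈-map⁻ toList p
    ... | _ , q , refl = refine-sound x xs I q

    complete′ : ∀ {J} → J ≼ (x ∷ xs) ∷ I → J ∈ map toList (refine x xs I)
    complete′ (((y ∷ ys) ∷ us) ∷ G , refl , refl)
      with refine-complete y ys us G
    ... | _ , p , eq = ∈-map-toList p eq

module ColouredSymmetricFunctions
  {c ℓ₁ ℓ₂ a : Level} (K : HeytingField c ℓ₁ ℓ₂)
  {A : Set a} {n : ℕ} (finite : A ↔ Fin n)
  where

  open HeytingField K
    using (0#; 1#; _+_; _*_)
    renaming (Carrier to 𝕜; _≈_ to _≈𝕜_)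
  open Sentences A public
  open Refinements A

  _≟ᴬ_ : DecidableEquality A
  _≟ᴬ_ = inj⇒≟ (↔⇒↣ finite)

  _≟ᵂ_ : DecidableEquality Word
  w ≟ᵂ v = map′ (λ { refl → refl }) (cong toList) (≡-dec _≟ᴬ_ (toList w) (toList v))

  _≟ˢ_ : DecidableEquality Sentence
  _≟ˢ_ = ≡-dec _≟ᵂ_

  δ : Sentence → Sentence → 𝕜
  δ I J = if does (I ≟ˢ J) then 1# else 0#

  Σ𝕜 : List 𝕜 → 𝕜
  Σ𝕜 = foldr _+_ 0#

  -- Elements are formal sums of terms c H_I.  Repetitions, zero coefficients
  -- and reorderings are allowed; they are identified by _≈_ below.
  NSym : Set (c ⊔ a)
  NSym = List (𝕜 × Sentence)

  H : Sentence → NSym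
  H I = (1# , I) ∷ []

  coefficient : NSym → Sentence → 𝕜
  coefficient x I = Σ𝕜 (map (λ (c , J) → c * δ J I) x)

  infix  4 _≈_
  infixl 6 _⊞_
  infixl 7 _⊠_

  _≈_ : NSym → NSym → Set (a ⊔ ℓ₁)
  x ≈ y = ∀ I → coefficient x I ≈𝕜 coefficient y I

  _⊞_ : NSym → NSym → NSym
  _⊞_ = _++_

  -- Bilinear extension of H_I H_J = H_{I·J}.
  _⊠_ : NSym → NSym → NSym
  _⊠_ = cartesianProductWith (λ (c , I) (d , J) → (c * d , I · J))

  -- Formal sums of terms c M_I.
  QSym : Set (c ⊔ a)
  QSym = List (𝕜 × Sentence)

  M : Sentence → QSym
  M I = (1# , I) ∷ []

  -- Bilinear extension of ⟨ M_I , H_J ⟩ = δ_{I,J}.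
  ⟨_,_⟩ : QSym → NSym → 𝕜
  ⟨ f , x ⟩ =
    Σ𝕜 (cartesianProductWith (λ (c , I) (d , J) → (c * d) * δ I J) f x)

  -- Addition of formal sums is _++_.
  F : Sentence → QSym
  F I = List.concatMap M (Enumeration.elements (refinements I))

  -- Since (F_I) is a basis of the graded dual, this determines R up to _≈_.
  IsRibbonFamily : (Sentence → NSym) → Set (a ⊔ ℓ₁)
  IsRibbonFamily R = ∀ I J → ⟨ F I , R J ⟩ ≈𝕜 δ I J

{-# OPTIONS --safe #-}
module Submission where

open import Defs
open import Algebra.Apartness.Bundles using (HeytingField; HeytingCommutativeRing)
open import Algebra.Bundles using (CommutativeRing)
import Algebra.Properties.CommutativeSemigroup as CommutativeSemigroupProperties
import Algebra.Properties.Ring as RingProperties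
open import Data.Bool.Base using (true; false; _∧_; if_then_else_)
open import Data.Bool.Properties using (∧-assoc; ∧-identityʳ; ∧-zeroʳ)
open import Data.Fin.Base using (Fin)
open import Data.List.Base using ([]; _∷_; _++_; map; concatMap)
open import Data.List.NonEmpty.Base using (_∷_; toList; _∷⁺_)
open import Data.List.Properties using (map-++; map-∘)
open import Data.Nat.Base using (ℕ)
open import Data.Product.Base using (_×_; _,_)
open import Function.Base using (_∘_)
open import Function.Bundles using (_↔_; mk⇔)
open import Level using (Level)
open import Relation.Binary.PropositionalEquality as ≡ using (_≡_; cong)
open import Relation.Nullary.Decidable using (does; does-⇔)

-- Let r_I(L) be the coefficient of H_L in R_I.  Being dual to F means that the
-- sum of r_I over the refinements of K is δ_{K,I}, and a function on sentences
-- is determined by its sums over refinements.  Every non-empty sentence is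
-- built from its last letter by two operations: prepending a letter x as a new
-- word (split x) or to the first word (glue x).  Comparing the sums gives
--   R_{x · I} = H_x R_I − glue_x R_I   and   R_{glue x I} = glue_x R_I,
-- where glue_x kills H_1 and sends H_L to H_{glue x L}.  As glue_x commutes with
-- right multiplication on the span of the H_L with L non-empty, the product rule
-- follows by induction on the letters of I.

module RibbonProduct
  {c ℓ₁ ℓ₂ a : Level} (K : HeytingField c ℓ₁ ℓ₂)
  {A : Set a} {n : ℕ} (finite : A ↔ Fin n)
  where

  open ColouredSymmetricFunctions K finite hiding (_≈_)
  open Refinements A
  open CommutativeRing
    (HeytingCommutativeRing.commutativeRing
      (HeytingField.heytingCommutativeRing K))
    hiding (zero) renaming (Carrier to 𝕜)
  open CommutativeSemigroupProperties +-commutativeSemigroup using (interchange)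
  open CommutativeSemigroupProperties *-commutativeSemigroup
    using () renaming (x∙yz≈y∙xz to x*yz≈y*xz)
  open RingProperties ring using (-‿distribˡ-*; +-cancelˡ)
  open import Relation.Binary.Reasoning.Setoid setoid

  -- Finite sums over the field

  Σ𝕜-++ : ∀ xs ys → Σ𝕜 (xs ++ ys) ≈ Σ𝕜 xs + Σ𝕜 ys
  Σ𝕜-++ []       ys = sym (+-identityˡ _)
  Σ𝕜-++ (x ∷ xs) ys = trans (+-congˡ (Σ𝕜-++ xs ys)) (sym (+-assoc _ _ _))

  Σ𝕜-map-++ : ∀ {b} {B : Set b} (f : B → 𝕜) xs ys →
              Σ𝕜 (map f (xs ++ ys)) ≈ Σ𝕜 (map f xs) + Σ𝕜 (map f ys)
  Σ𝕜-map-++ f xs ys =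
    trans (reflexive (cong Σ𝕜 (map-++ f xs ys))) (Σ𝕜-++ (map f xs) (map f ys))

  Σ𝕜-map-cong : ∀ {b} {B : Set b} {f g : B → 𝕜} → (∀ x → f x ≈ g x) →
                ∀ xs → Σ𝕜 (map f xs) ≈ Σ𝕜 (map g xs)
  Σ𝕜-map-cong f≈g []       = refl
  Σ𝕜-map-cong f≈g (x ∷ xs) = +-cong (f≈g x) (Σ𝕜-map-cong f≈g xs)

  Σ𝕜-map-* : ∀ {b} {B : Set b} k (f : B → 𝕜) xs →
             Σ𝕜 (map (λ x → k * f x) xs) ≈ k * Σ𝕜 (map f xs)
  Σ𝕜-map-* k f []       = sym (zeroʳ k)
  Σ𝕜-map-* k f (x ∷ xs) = trans (+-congˡ (Σ𝕜-map-* k f xs)) (sym (distribˡ _ _ _))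

  coefficient-++ : ∀ x y L → coefficient (x ++ y) L ≈ coefficient x L + coefficient y L
  coefficient-++ x y L = Σ𝕜-map-++ _ x y

  -- Kronecker deltas on sentences

  δ-sym : ∀ I J → δ I J ≡ δ J I
  δ-sym I J = cong (if_then 1# else 0#) (does-⇔ (mk⇔ ≡.sym ≡.sym) (I ≟ˢ J) (J ≟ˢ I))

  [_≟_] : A → A → 𝕜
  [ x ≟ y ] = if does (x ≟ᴬ y) then 1# else 0#

  private
    indicator-∧ : ∀ b b′ → (if b ∧ b′ then 1# else 0#) ≈
                  (if b then 1# else 0#) * (if b′ then 1# else 0#)
    indicator-∧ false b′ = sym (zeroˡ _)
    indicator-∧ true  b′ = sym (*-identityˡ _)

  δ-∷ : ∀ v w I L → δ (v ∷ I) (w ∷ L) ≈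
        (if does (v ≟ᵂ w) then 1# else 0#) * δ I L
  δ-∷ v w I L = indicator-∧ (does (v ≟ᵂ w)) (does (I ≟ˢ L))

  δ-split-split : ∀ y x M I →
                  δ ((y ∷ []) ∷ M) ((x ∷ []) ∷ I) ≈ [ y ≟ x ] * δ M I
  δ-split-split y x M I = trans
    (reflexive (cong (λ b → if b ∧ does (M ≟ˢ I) then 1# else 0#)
      (∧-identityʳ (does (y ≟ᴬ x)))))
    (indicator-∧ (does (y ≟ᴬ x)) (does (M ≟ˢ I)))

  -- The first word is a single letter on one side and has at least two letters on the other.
  δ-split-glue : ∀ y x M I → δ ((y ∷ []) ∷ M) (toList (glue x I)) ≈ 0#
  δ-split-glue y x M ((v ∷ vs) ∷ I) =
    reflexive (cong (λ b → if b ∧ does (M ≟ˢ I) then 1# else 0#)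
      (∧-zeroʳ (does (y ≟ᴬ x))))

  δ-glue-split : ∀ y x L I → δ (toList (glue y L)) ((x ∷ []) ∷ I) ≈ 0#
  δ-glue-split y x L I =
    trans (reflexive (δ-sym (toList (glue y L)) ((x ∷ []) ∷ I))) (δ-split-glue x y I L)

  δ-glue-glue : ∀ y x L I → δ (toList (glue y L)) (toList (glue x I)) ≈
                [ y ≟ x ] * δ (toList L) (toList I)
  δ-glue-glue y x (w ∷ L) (v ∷ I) = trans
    (reflexive (cong (if_then 1# else 0#)
      (∧-assoc (does (y ≟ᴬ x)) (does (w ≟ᵂ v)) (does (L ≟ˢ I)))))
    (indicator-∧ (does (y ≟ᴬ x)) (does (w ≟ᵂ v) ∧ does (L ≟ˢ I)))

  -- Convolution of coefficient functions

  -- The sum of `f I * g J` over all cuts of the argument into `I · J`. Each step moves a word into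
  -- the argument of `f`, so the lemmas below are proved for all `f` at once.
  conv : (f g : Sentence → 𝕜) → Sentence → 𝕜
  conv f g []      = f [] * g []
  conv f g (w ∷ L) = f [] * g (w ∷ L) + conv (f ∘ (w ∷_)) g L

  conv-congˡ : ∀ {f f′} g → (∀ L → f L ≈ f′ L) → ∀ L → conv f g L ≈ conv f′ g L
  conv-congˡ g f≈f′ []      = *-congʳ (f≈f′ [])
  conv-congˡ g f≈f′ (w ∷ L) =
    +-cong (*-congʳ (f≈f′ [])) (conv-congˡ g (f≈f′ ∘ (w ∷_)) L)

  conv-*ˡ : ∀ k f g L → conv (λ I → k * f I) g L ≈ k * conv f g L
  conv-*ˡ k f g []      = *-assoc _ _ _
  conv-*ˡ k f g (w ∷ L) =
    trans (+-cong (*-assoc _ _ _) (conv-*ˡ k (f ∘ (w ∷_)) g L)) (sym (distribˡ _ _ _))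

  conv-+ˡ : ∀ f f′ g L → conv (λ I → f I + f′ I) g L ≈ conv f g L + conv f′ g L
  conv-+ˡ f f′ g []      = distribʳ _ _ _
  conv-+ˡ f f′ g (w ∷ L) =
    trans (+-cong (distribʳ _ _ _) (conv-+ˡ (f ∘ (w ∷_)) (f′ ∘ (w ∷_)) g L))
          (interchange _ _ _ _)

  conv-0ˡ : ∀ g L → conv (λ _ → 0#) g L ≈ 0#
  conv-0ˡ g []      = zeroˡ _
  conv-0ˡ g (w ∷ L) = trans (+-cong (zeroˡ _) (conv-0ˡ g L)) (+-identityˡ _)

  conv-*ʳ : ∀ k f g L → conv f (λ I → k * g I) L ≈ k * conv f g L
  conv-*ʳ k f g []      = x*yz≈y*xz _ _ _
  conv-*ʳ k f g (w ∷ L) =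
    trans (+-cong (x*yz≈y*xz _ _ _) (conv-*ʳ k (f ∘ (w ∷_)) g L)) (sym (distribˡ _ _ _))

  conv-+ʳ : ∀ f g g′ L → conv f (λ I → g I + g′ I) L ≈ conv f g L + conv f g′ L
  conv-+ʳ f g g′ []      = distribˡ _ _ _
  conv-+ʳ f g g′ (w ∷ L) =
    trans (+-cong (distribˡ _ _ _) (conv-+ʳ (f ∘ (w ∷_)) g g′ L)) (interchange _ _ _ _)

  conv-0ʳ : ∀ f L → conv f (λ _ → 0#) L ≈ 0#
  conv-0ʳ f []      = zeroʳ _
  conv-0ʳ f (w ∷ L) = trans (+-cong (zeroʳ _) (conv-0ʳ (f ∘ (w ∷_)) L)) (+-identityˡ _)

  conv-identityˡ : ∀ g L → conv (δ []) g L ≈ g L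
  conv-identityˡ g []      = *-identityˡ _
  conv-identityˡ g (w ∷ L) =
    trans (+-cong (*-identityˡ _) (conv-0ˡ g L)) (+-identityʳ _)

  -- The cut with empty prefix drops out. This applies to `f = r I` with `I` non-empty and hands the
  -- first word of the sentence to the first factor.
  conv-∷ : ∀ f g w L → f [] ≈ 0# → conv f g (w ∷ L) ≈ conv (f ∘ (w ∷_)) g L
  conv-∷ f g w L f[]≈0 =
    trans (+-congʳ (trans (*-congʳ f[]≈0) (zeroˡ _))) (+-identityˡ _)

  -- The multiplication rule of the basis `H`, read on coefficients.
  conv-δ : ∀ I J L → conv (δ I) (δ J) L ≈ δ (I · J) L
  conv-δ []      J L       = conv-identityˡ (δ J) L
  conv-δ (v ∷ I) J []      = zeroˡ _
  conv-δ (v ∷ I) J (w ∷ L) = begin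
    conv (δ (v ∷ I)) (δ J) (w ∷ L)
      ≈⟨ conv-∷ (δ (v ∷ I)) (δ J) w L refl ⟩
    conv (δ (v ∷ I) ∘ (w ∷_)) (δ J) L
      ≈⟨ conv-congˡ (δ J) (δ-∷ v w I) L ⟩
    conv (λ N → _ * δ I N) (δ J) L
      ≈⟨ conv-*ˡ _ (δ I) (δ J) L ⟩
    _ * conv (δ I) (δ J) L
      ≈⟨ *-congˡ (conv-δ I J L) ⟩
    _ * δ (I · J) L
      ≈⟨ δ-∷ v w (I · J) L ⟨
    δ (v ∷ I · J) (w ∷ L) ∎

  -- The list is the row that a single term `(k , I)` produces in `cartesianProductWith`;
  -- `coefficient-⊠` adds up such rows.
  coefficient-monomial-⊠ : ∀ k I (y : NSym) L →
    coefficient (map (λ (d , J) → (k * d , I · J)) y) L ≈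
    k * conv (δ I) (coefficient y) L
  coefficient-monomial-⊠ k I [] L =
    sym (trans (*-congˡ (conv-0ʳ (δ I) L)) (zeroʳ k))
  coefficient-monomial-⊠ k I ((d , J) ∷ y) L = begin
    (k * d) * δ (I · J) L + _
      ≈⟨ +-cong (*-assoc _ _ _) (coefficient-monomial-⊠ k I y L) ⟩
    k * (d * δ (I · J) L) + k * conv (δ I) (coefficient y) L
      ≈⟨ distribˡ _ _ _ ⟨
    k * (d * δ (I · J) L + conv (δ I) (coefficient y) L)
      ≈⟨ *-congˡ (+-congʳ (*-congˡ (conv-δ I J L))) ⟨
    k * (d * conv (δ I) (δ J) L + conv (δ I) (coefficient y) L)
      ≈⟨ *-congˡ (+-congʳ (conv-*ʳ d (δ I) (δ J) L)) ⟨
    k * (conv (δ I) (λ N → d * δ J N) L + conv (δ I) (coefficient y) L)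
      ≈⟨ *-congˡ (conv-+ʳ (δ I) _ _ L) ⟨
    k * conv (δ I) (coefficient ((d , J) ∷ y)) L ∎

  coefficient-⊠ : ∀ x y L →
    coefficient (x ⊠ y) L ≈ conv (coefficient x) (coefficient y) L
  coefficient-⊠ []            y L = sym (conv-0ˡ (coefficient y) L)
  coefficient-⊠ ((k , I) ∷ x) y L = begin
    coefficient (((k , I) ∷ x) ⊠ y) L
      ≈⟨ coefficient-++ (map _ y) (x ⊠ y) L ⟩
    coefficient (map _ y) L + coefficient (x ⊠ y) L
      ≈⟨ +-cong (coefficient-monomial-⊠ k I y L) (coefficient-⊠ x y L) ⟩
    k * conv (δ I) (coefficient y) L + conv (coefficient x) (coefficient y) L
      ≈⟨ +-congʳ (conv-*ˡ k (δ I) (coefficient y) L) ⟨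
    conv (λ N → k * δ I N) (coefficient y) L + conv (coefficient x) (coefficient y) L
      ≈⟨ conv-+ˡ _ _ (coefficient y) L ⟨
    conv (coefficient ((k , I) ∷ x)) (coefficient y) L ∎

  -- Sums over refinements

  ζ : (Sentence → 𝕜) → Sentence → 𝕜
  ζ f I = Σ𝕜 (map f (Enumeration.elements (refinements I)))

  -- The recursion on letters produces functions such as `f ∘ glue x`, which live on non-empty
  -- sentences only; this variant of `ζ` accepts them.
  ζ⁺ : (NonEmptySentence → 𝕜) → NonEmptySentence → 𝕜
  ζ⁺ f ((x ∷ xs) ∷ I) = Σ𝕜 (map f (refine x xs I))

  ζ-toList : ∀ f L → ζ f (toList L) ≡ ζ⁺ (f ∘ toList) L
  ζ-toList f ((x ∷ xs) ∷ I) = cong Σ𝕜 (≡.sym (map-∘ (refine x xs I)))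

  -- A one-letter first word cannot be cut further, so refining the sentence means refining `M`
  -- behind it.
  ζ⁺-split : ∀ f x M → ζ⁺ f ((x ∷ []) ∷ M) ≡ ζ (λ N → f ((x ∷ []) ∷ N)) M
  ζ⁺-split f x []             = ≡.refl
  ζ⁺-split f x ((y ∷ ys) ∷ M) =
    cong Σ𝕜 (≡.trans (≡.sym (map-∘ (refine y ys M))) (map-∘ (refine y ys M)))

  -- A refinement of `glue x L` either has a cut right after `x` or has none there; in both cases
  -- the rest is a refinement of `L`.
  ζ⁺-glue : ∀ f x L → ζ⁺ f (glue x L) ≈
            ζ (λ N → f ((x ∷ []) ∷ N)) (toList L) + ζ⁺ (f ∘ glue x) L
  ζ⁺-glue f x ((y ∷ ys) ∷ M) = begin
    Σ𝕜 (map f (map (split x) Ls ++ map (glue x) Ls))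
      ≈⟨ Σ𝕜-map-++ f (map (split x) Ls) (map (glue x) Ls) ⟩
    Σ𝕜 (map f (map (split x) Ls)) + Σ𝕜 (map f (map (glue x) Ls))
      ≡⟨ ≡.cong₂ (λ u v → Σ𝕜 u + Σ𝕜 v)
           (≡.trans (≡.sym (map-∘ Ls)) (map-∘ Ls)) (≡.sym (map-∘ Ls)) ⟩
    ζ (λ N → f ((x ∷ []) ∷ N)) ((y ∷ ys) ∷ M) + Σ𝕜 (map (f ∘ glue x) Ls) ∎
    where Ls = refine y ys M

  ζ-split : ∀ f x M → ζ f ((x ∷ []) ∷ M) ≡ ζ (f ∘ ((x ∷ []) ∷_)) M
  ζ-split f x M = ≡.trans (ζ-toList f ((x ∷ []) ∷ M)) (ζ⁺-split (f ∘ toList) x M)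

  -- The refinements with a cut after `x` are those of `split x L`, so their part of the sum is
  -- again a value of `ζ f`.
  ζ-glue : ∀ f x L → ζ f (toList (glue x L)) ≈
           ζ f ((x ∷ []) ∷ toList L) + ζ⁺ (f ∘ toList ∘ glue x) L
  ζ-glue f x L = begin
    ζ f (toList (glue x L))
      ≡⟨ ζ-toList f (glue x L) ⟩
    ζ⁺ (f ∘ toList) (glue x L)
      ≈⟨ ζ⁺-glue (f ∘ toList) x L ⟩
    ζ (f ∘ ((x ∷ []) ∷_)) (toList L) + ζ⁺ (f ∘ toList ∘ glue x) L
      ≈⟨ +-congʳ (reflexive (ζ-split f x (toList L))) ⟨
    ζ f ((x ∷ []) ∷ toList L) + ζ⁺ (f ∘ toList ∘ glue x) L ∎

  ζ-* : ∀ k f I → ζ (λ L → k * f L) I ≈ k * ζ f I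
  ζ-* k f I = Σ𝕜-map-* k f (Enumeration.elements (refinements I))

  -- Uniqueness in Möbius inversion, by mutual recursion on the letters of the sentence. The
  -- functions change along the way: they are restricted to sentences built by `split x` or by
  -- `glue x`.
  ζ-injective : ∀ f g → (∀ I → ζ f I ≈ ζ g I) → ∀ L → f L ≈ g L
  ζ⁺-injective : ∀ f g → (∀ I → ζ⁺ f I ≈ ζ⁺ g I) →
                 ∀ x xs M → f ((x ∷ xs) ∷ M) ≈ g ((x ∷ xs) ∷ M)
  ζ-injective f g ζf≈ζg [] =
    trans (sym (+-identityʳ _)) (trans (ζf≈ζg []) (+-identityʳ _))
  ζ-injective f g ζf≈ζg ((x ∷ xs) ∷ M) =
    ζ⁺-injective (f ∘ toList) (g ∘ toList)
      (λ I → trans (reflexive (≡.sym (ζ-toList f I)))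
               (trans (ζf≈ζg (toList I)) (reflexive (ζ-toList g I))))
      x xs M
  ζ⁺-injective f g ζf≈ζg x [] M =
    ζ-injective _ _
      (λ I → trans (reflexive (≡.sym (ζ⁺-split f x I)))
               (trans (ζf≈ζg ((x ∷ []) ∷ I)) (reflexive (ζ⁺-split g x I))))
      M
  ζ⁺-injective f g ζf≈ζg x (y ∷ ys) M =
    ζ⁺-injective (f ∘ glue x) (g ∘ glue x) ζ⁺-glued y ys M
    where
    ζ⁺-glued : ∀ I → ζ⁺ (f ∘ glue x) I ≈ ζ⁺ (g ∘ glue x) I
    -- The summands with a cut after `x` add up to a value at `split x I`, where the hypothesis
    -- makes both sides agree; cancelling leaves the glued summands.
    ζ⁺-glued I = +-cancelˡ (ζ (λ N → f ((x ∷ []) ∷ N)) (toList I)) _ _ (begin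
      ζ (λ N → f ((x ∷ []) ∷ N)) (toList I) + ζ⁺ (f ∘ glue x) I
        ≈⟨ ζ⁺-glue f x I ⟨
      ζ⁺ f (glue x I)
        ≈⟨ ζf≈ζg (glue x I) ⟩
      ζ⁺ g (glue x I)
        ≈⟨ ζ⁺-glue g x I ⟩
      ζ (λ N → g ((x ∷ []) ∷ N)) (toList I) + ζ⁺ (g ∘ glue x) I
        ≈⟨ +-congʳ (reflexive (ζ⁺-split g x (toList I))) ⟨
      ζ⁺ g ((x ∷ []) ∷ toList I) + ζ⁺ (g ∘ glue x) I
        ≈⟨ +-congʳ (ζf≈ζg ((x ∷ []) ∷ toList I)) ⟨
      ζ⁺ f ((x ∷ []) ∷ toList I) + ζ⁺ (g ∘ glue x) I
        ≈⟨ +-congʳ (reflexive (ζ⁺-split f x (toList I))) ⟩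
      ζ (λ N → f ((x ∷ []) ∷ N)) (toList I) + ζ⁺ (g ∘ glue x) I ∎)

  -- Duality with the fundamental functions

  ⟨concatMap-M,-⟩ : ∀ Is x → ⟨ concatMap M Is , x ⟩ ≈ Σ𝕜 (map (coefficient x) Is)
  ⟨concatMap-M,-⟩ []       x = refl
  ⟨concatMap-M,-⟩ (I ∷ Is) x = begin
    ⟨ concatMap M (I ∷ Is) , x ⟩
      ≈⟨ Σ𝕜-++ (map _ x) _ ⟩
    Σ𝕜 (map (λ (d , J) → (1# * d) * δ I J) x) + ⟨ concatMap M Is , x ⟩
      ≈⟨ +-cong (Σ𝕜-map-cong term x) (⟨concatMap-M,-⟩ Is x) ⟩
    coefficient x I + Σ𝕜 (map (coefficient x) Is) ∎
    where
    term : ∀ ((d , J) : 𝕜 × Sentence) → (1# * d) * δ I J ≈ d * δ J I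
    term (d , J) = *-cong (*-identityˡ d) (reflexive (δ-sym I J))

  ⟨F,-⟩ : ∀ I x → ⟨ F I , x ⟩ ≈ ζ (coefficient x) I
  ⟨F,-⟩ I x = ⟨concatMap-M,-⟩ (Enumeration.elements (refinements I)) x

  -- `nearConcat` branches on the words after the first; once that is decided, both sides compute to
  -- the same sentence.
  nearConcat-glue : ∀ x w I J → nearConcat (x ∷⁺ w) I J ≡ glue x (nearConcat w I J)
  nearConcat-glue x w []      (v ∷ J) = ≡.refl
  nearConcat-glue x w (u ∷ I) J       = ≡.refl

  -- Coefficients of ribbons

  module _ (R : Sentence → NSym) (ribbon : IsRibbonFamily R) where

    r : Sentence → Sentence → 𝕜
    r I = coefficient (R I)

    -- Duality as a condition on sums over refinements; everything about `R` below rests on it.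
    ζ-r : ∀ I L → ζ (r I) L ≈ δ L I
    ζ-r I L = trans (sym (⟨F,-⟩ L (R I))) (ribbon L I)

    -- By injectivity of `ζ`. It is applied to functions obtained from `r` by fixing the first
    -- letter of the tested sentence; `k = 0#` gives vanishing.
    ζ≈*δ⇒≈*r : ∀ f k I → (∀ L → ζ f L ≈ k * δ L I) → ∀ L → f L ≈ k * r I L
    ζ≈*δ⇒≈*r f k I ζf≈ = ζ-injective f (λ L → k * r I L) λ L →
      trans (ζf≈ L) (sym (trans (ζ-* k (r I) L) (*-congˡ (ζ-r I L))))

    ζ⁺≈*δ⇒≈*r : ∀ f k I → (∀ L → ζ⁺ f L ≈ k * δ (toList L) I) →
                ∀ L → f L ≈ k * r I (toList L)
    ζ⁺≈*δ⇒≈*r f k I ζf≈ ((x ∷ xs) ∷ M) =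
      ζ⁺-injective f (λ L → k * r I (toList L))
        (λ L → trans (ζf≈ L) (sym (begin
          ζ⁺ (λ L → k * r I (toList L)) L ≡⟨ ζ-toList (λ L → k * r I L) L ⟨
          ζ (λ L → k * r I L) (toList L)  ≈⟨ ζ-* k (r I) (toList L) ⟩
          k * ζ (r I) (toList L)          ≈⟨ *-congˡ (ζ-r I (toList L)) ⟩
          k * δ (toList L) I              ∎)))
        x xs M

    r-[] : ∀ I → r I [] ≈ δ [] I
    r-[] I = trans (sym (+-identityʳ _)) (ζ-r I [])

    -- So `R []` is the unit: the sums at non-empty sentences all vanish, and inversion kills the
    -- coefficients there.
    r[]≈δ[] : ∀ L → r [] L ≈ δ [] L
    r[]≈δ[] []      = r-[] []
    r[]≈δ[] (w ∷ L) = trans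
      (ζ⁺≈*δ⇒≈*r (r [] ∘ toList) 0# [] ζ≈0 (w ∷ L)) (zeroˡ _)
      where
      ζ≈0 : ∀ L → ζ⁺ (r [] ∘ toList) L ≈ 0# * δ (toList L) []
      ζ≈0 L@(_ ∷ _) = begin
        ζ⁺ (r [] ∘ toList) L ≡⟨ ζ-toList (r []) L ⟨
        ζ (r []) (toList L)  ≈⟨ ζ-r [] (toList L) ⟩
        0#                   ≈⟨ zeroˡ _ ⟨
        0# * 0#              ∎

    -- The first of four rules, according to how the first letters `x` of the index and `y` of the
    -- tested sentence are attached. Here `ζ-split` lets `y` pass through the sum.
    r-split-split : ∀ x y I M →
      r ((x ∷ []) ∷ I) ((y ∷ []) ∷ M) ≈ [ y ≟ x ] * r I M
    r-split-split x y I = ζ≈*δ⇒≈*r _ [ y ≟ x ] I λ M → begin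
      ζ (r ((x ∷ []) ∷ I) ∘ ((y ∷ []) ∷_)) M ≡⟨ ζ-split (r ((x ∷ []) ∷ I)) y M ⟨
      ζ (r ((x ∷ []) ∷ I)) ((y ∷ []) ∷ M)    ≈⟨ ζ-r ((x ∷ []) ∷ I) ((y ∷ []) ∷ M) ⟩
      δ ((y ∷ []) ∷ M) ((x ∷ []) ∷ I)        ≈⟨ δ-split-split y x M I ⟩
      [ y ≟ x ] * δ M I                      ∎

    r-glue-split : ∀ x y I M → r (toList (glue x I)) ((y ∷ []) ∷ M) ≈ 0#
    -- With the scalar `0#` any index would do; `[]` is a placeholder.
    r-glue-split x y I M = trans (ζ≈*δ⇒≈*r _ 0# [] ζ≈0 M) (zeroˡ _)
      where
      ζ≈0 : ∀ M → ζ (r (toList (glue x I)) ∘ ((y ∷ []) ∷_)) M ≈ 0# * δ M []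
      ζ≈0 M = begin
        ζ (r (toList (glue x I)) ∘ ((y ∷ []) ∷_)) M
          ≡⟨ ζ-split (r (toList (glue x I))) y M ⟨
        ζ (r (toList (glue x I))) ((y ∷ []) ∷ M)
          ≈⟨ ζ-r (toList (glue x I)) ((y ∷ []) ∷ M) ⟩
        δ ((y ∷ []) ∷ M) (toList (glue x I))
          ≈⟨ δ-split-glue y x M I ⟩
        0#
          ≈⟨ zeroˡ _ ⟨
        0# * δ M [] ∎

    -- The source of both rules for tested sentences `glue y L`: the sums over glued refinements are
    -- a difference of two deltas.
    ζ⁺-r-glue : ∀ I y L →
      δ ((y ∷ []) ∷ toList L) I + ζ⁺ (r I ∘ toList ∘ glue y) L ≈
      δ (toList (glue y L)) I
    ζ⁺-r-glue I y L = begin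
      δ ((y ∷ []) ∷ toList L) I + ζ⁺ (r I ∘ toList ∘ glue y) L
        ≈⟨ +-congʳ (ζ-r I ((y ∷ []) ∷ toList L)) ⟨
      ζ (r I) ((y ∷ []) ∷ toList L) + ζ⁺ (r I ∘ toList ∘ glue y) L
        ≈⟨ ζ-glue (r I) y L ⟨
      ζ (r I) (toList (glue y L))
        ≈⟨ ζ-r I (toList (glue y L)) ⟩
      δ (toList (glue y L)) I ∎

    -- Only the subtracted delta, the one at `split y L`, can be non-zero; this is where the sign
    -- comes from.
    r-split-glue : ∀ x y I L →
      r ((x ∷ []) ∷ I) (toList (glue y L)) ≈ - [ y ≟ x ] * r I (toList L)
    r-split-glue x y I = ζ⁺≈*δ⇒≈*r _ (- [ y ≟ x ]) I λ L →
      +-cancelˡ ([ y ≟ x ] * δ (toList L) I) _ _ (begin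
        [ y ≟ x ] * δ (toList L) I + ζ⁺ (r ((x ∷ []) ∷ I) ∘ toList ∘ glue y) L
          ≈⟨ +-congʳ (δ-split-split y x (toList L) I) ⟨
        δ ((y ∷ []) ∷ toList L) ((x ∷ []) ∷ I) +
          ζ⁺ (r ((x ∷ []) ∷ I) ∘ toList ∘ glue y) L
          ≈⟨ ζ⁺-r-glue ((x ∷ []) ∷ I) y L ⟩
        δ (toList (glue y L)) ((x ∷ []) ∷ I)
          ≈⟨ δ-glue-split y x L I ⟩
        0#
          ≈⟨ -‿inverseʳ _ ⟨
        [ y ≟ x ] * δ (toList L) I - [ y ≟ x ] * δ (toList L) I
          ≈⟨ +-congˡ (-‿distribˡ-* _ _) ⟩
        [ y ≟ x ] * δ (toList L) I + - [ y ≟ x ] * δ (toList L) I ∎)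

    -- Here the delta at `split y L` vanishes, so no sign appears.
    r-glue-glue : ∀ x y I L →
      r (toList (glue x I)) (toList (glue y L)) ≈ [ y ≟ x ] * r (toList I) (toList L)
    r-glue-glue x y I = ζ⁺≈*δ⇒≈*r _ [ y ≟ x ] (toList I) λ L → begin
      ζ⁺ (r (toList (glue x I)) ∘ toList ∘ glue y) L
        ≈⟨ +-identityˡ _ ⟨
      0# + ζ⁺ (r (toList (glue x I)) ∘ toList ∘ glue y) L
        ≈⟨ +-congʳ (δ-split-glue y x (toList L) I) ⟨
      δ ((y ∷ []) ∷ toList L) (toList (glue x I)) +
        ζ⁺ (r (toList (glue x I)) ∘ toList ∘ glue y) L
        ≈⟨ ζ⁺-r-glue (toList (glue x I)) y L ⟩
      δ (toList (glue y L)) (toList (glue x I))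
        ≈⟨ δ-glue-glue y x L I ⟩
      [ y ≟ x ] * δ (toList L) (toList I) ∎

    -- The product rule on coefficients

    conv-scaled : ∀ {f} k f′ g → (∀ L → f L ≈ k * f′ L) →
                  ∀ L → conv f g L ≈ k * conv f′ g L
    conv-scaled k f′ g f≈ L = trans (conv-congˡ g f≈ L) (conv-*ˡ k f′ g L)

    -- Recursion on the letters of the first index, for every tested sentence. The attachment of `x`
    -- and of the first letter `y` of that sentence selects which of the four rules apply.
    conv-r : ∀ x xs I J L →
      conv (r ((x ∷ xs) ∷ I)) (r (toList J)) L ≈
      r (((x ∷ xs) ∷ I) · toList J) L + r (toList (((x ∷ xs) ∷ I) ⊙ J)) L
    conv-r x xs I J [] = begin
      r ((x ∷ xs) ∷ I) [] * r (toList J) []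
        ≈⟨ *-congʳ (r-[] ((x ∷ xs) ∷ I)) ⟩
      0# * r (toList J) []
        ≈⟨ zeroˡ _ ⟩
      0#
        ≈⟨ +-identityˡ _ ⟨
      0# + 0#
        ≈⟨ +-cong (r-[] (((x ∷ xs) ∷ I) · toList J)) (r-[] (toList (((x ∷ xs) ∷ I) ⊙ J))) ⟨
      r (((x ∷ xs) ∷ I) · toList J) [] + r (toList (((x ∷ xs) ∷ I) ⊙ J)) [] ∎
    -- Here `⊙` computes to `glue x J`, whose ribbon vanishes on a one-letter first word; only the
    -- concatenation contributes.
    conv-r x [] [] J ((y ∷ []) ∷ M) = begin
      conv (r ((x ∷ []) ∷ [])) (r (toList J)) ((y ∷ []) ∷ M)
        ≈⟨ conv-∷ (r ((x ∷ []) ∷ [])) _ _ M (r-[] ((x ∷ []) ∷ [])) ⟩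
      conv (r ((x ∷ []) ∷ []) ∘ ((y ∷ []) ∷_)) (r (toList J)) M
        ≈⟨ conv-scaled [ y ≟ x ] (r []) (r (toList J)) (r-split-split x y []) M ⟩
      [ y ≟ x ] * conv (r []) (r (toList J)) M
        ≈⟨ *-congˡ (conv-congˡ (r (toList J)) r[]≈δ[] M) ⟩
      [ y ≟ x ] * conv (δ []) (r (toList J)) M
        ≈⟨ *-congˡ (conv-identityˡ (r (toList J)) M) ⟩
      [ y ≟ x ] * r (toList J) M
        ≈⟨ +-identityʳ _ ⟨
      [ y ≟ x ] * r (toList J) M + 0#
        ≈⟨ +-cong (r-split-split x y (toList J) M) (r-glue-split x y J M) ⟨
      r ((x ∷ []) ∷ toList J) ((y ∷ []) ∷ M) + r (toList (glue x J)) ((y ∷ []) ∷ M) ∎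
    conv-r x [] [] J ((y ∷ z ∷ zs) ∷ M) = begin
      conv (r ((x ∷ []) ∷ [])) (r (toList J)) ((y ∷ z ∷ zs) ∷ M)
        ≈⟨ conv-∷ (r ((x ∷ []) ∷ [])) _ _ M (r-[] ((x ∷ []) ∷ [])) ⟩
      conv (r ((x ∷ []) ∷ []) ∘ ((y ∷ z ∷ zs) ∷_)) (r (toList J)) M
        ≈⟨ conv-scaled (- [ y ≟ x ]) (r [] ∘ ((z ∷ zs) ∷_)) (r (toList J))
             (λ N → r-split-glue x y [] ((z ∷ zs) ∷ N)) M ⟩
      - [ y ≟ x ] * conv (r [] ∘ ((z ∷ zs) ∷_)) (r (toList J)) M
        ≈⟨ *-congˡ (conv-congˡ (r (toList J)) (r[]≈δ[] ∘ ((z ∷ zs) ∷_)) M) ⟩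
      - [ y ≟ x ] * conv (λ _ → 0#) (r (toList J)) M
        ≈⟨ *-congˡ (conv-0ˡ (r (toList J)) M) ⟩
      - [ y ≟ x ] * 0#
        ≈⟨ zeroʳ _ ⟩
      -- The left side is zero because `r []` vanishes on non-empty sentences. On the right the two
      -- ribbons cancel: `x` is split off in one and glued on in the other, with opposite signs.
      0#
        ≈⟨ -‿inverseˡ _ ⟨
      - ([ y ≟ x ] * r (toList J) ((z ∷ zs) ∷ M)) + [ y ≟ x ] * r (toList J) ((z ∷ zs) ∷ M)
        ≈⟨ +-congʳ (-‿distribˡ-* _ _) ⟩
      - [ y ≟ x ] * r (toList J) ((z ∷ zs) ∷ M) + [ y ≟ x ] * r (toList J) ((z ∷ zs) ∷ M)
        ≈⟨ +-cong (r-split-glue x y (toList J) ((z ∷ zs) ∷ M))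
                  (r-glue-glue x y J ((z ∷ zs) ∷ M)) ⟨
      r ((x ∷ []) ∷ toList J) ((y ∷ z ∷ zs) ∷ M) +
        r (toList (glue x J)) ((y ∷ z ∷ zs) ∷ M) ∎
    -- Since `w` follows, `·` and `⊙` both act behind the word `x`, and the recursion applies to
    -- `w ∷ I`.
    conv-r x [] (w@(x′ ∷ xs′) ∷ I) J ((y ∷ []) ∷ M) = begin
      conv (r ((x ∷ []) ∷ w ∷ I)) (r (toList J)) ((y ∷ []) ∷ M)
        ≈⟨ conv-∷ (r ((x ∷ []) ∷ w ∷ I)) _ _ M (r-[] ((x ∷ []) ∷ w ∷ I)) ⟩
      conv (r ((x ∷ []) ∷ w ∷ I) ∘ ((y ∷ []) ∷_)) (r (toList J)) M
        ≈⟨ conv-scaled [ y ≟ x ] (r (w ∷ I)) (r (toList J)) (r-split-split x y (w ∷ I)) M ⟩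
      [ y ≟ x ] * conv (r (w ∷ I)) (r (toList J)) M
        ≈⟨ *-congˡ (conv-r x′ xs′ I J M) ⟩
      [ y ≟ x ] * (r ((w ∷ I) · toList J) M + r (toList ((w ∷ I) ⊙ J)) M)
        ≈⟨ distribˡ _ _ _ ⟩
      [ y ≟ x ] * r ((w ∷ I) · toList J) M + [ y ≟ x ] * r (toList ((w ∷ I) ⊙ J)) M
        ≈⟨ +-cong (r-split-split x y ((w ∷ I) · toList J) M)
                  (r-split-split x y (toList ((w ∷ I) ⊙ J)) M) ⟨
      r (((x ∷ []) ∷ w ∷ I) · toList J) ((y ∷ []) ∷ M) +
        r (toList (((x ∷ []) ∷ w ∷ I) ⊙ J)) ((y ∷ []) ∷ M) ∎
    conv-r x [] (w@(x′ ∷ xs′) ∷ I) J ((y ∷ z ∷ zs) ∷ M) = begin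
      conv (r ((x ∷ []) ∷ w ∷ I)) (r (toList J)) ((y ∷ z ∷ zs) ∷ M)
        ≈⟨ conv-∷ (r ((x ∷ []) ∷ w ∷ I)) _ _ M (r-[] ((x ∷ []) ∷ w ∷ I)) ⟩
      conv (r ((x ∷ []) ∷ w ∷ I) ∘ ((y ∷ z ∷ zs) ∷_)) (r (toList J)) M
        ≈⟨ conv-scaled (- [ y ≟ x ]) (r (w ∷ I) ∘ ((z ∷ zs) ∷_)) (r (toList J))
             (λ N → r-split-glue x y (w ∷ I) ((z ∷ zs) ∷ N)) M ⟩
      - [ y ≟ x ] * conv (r (w ∷ I) ∘ ((z ∷ zs) ∷_)) (r (toList J)) M
        -- The empty-prefix term, being zero, is put back, so that this becomes a full convolution
        -- at `(z ∷ zs) ∷ M`, to which the recursion applies.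
        ≈⟨ *-congˡ (conv-∷ (r (w ∷ I)) _ _ M (r-[] (w ∷ I))) ⟨
      - [ y ≟ x ] * conv (r (w ∷ I)) (r (toList J)) ((z ∷ zs) ∷ M)
        ≈⟨ *-congˡ (conv-r x′ xs′ I J ((z ∷ zs) ∷ M)) ⟩
      - [ y ≟ x ] * (r ((w ∷ I) · toList J) ((z ∷ zs) ∷ M) +
                     r (toList ((w ∷ I) ⊙ J)) ((z ∷ zs) ∷ M))
        ≈⟨ distribˡ _ _ _ ⟩
      - [ y ≟ x ] * r ((w ∷ I) · toList J) ((z ∷ zs) ∷ M) +
        - [ y ≟ x ] * r (toList ((w ∷ I) ⊙ J)) ((z ∷ zs) ∷ M)
        ≈⟨ +-cong (r-split-glue x y ((w ∷ I) · toList J) ((z ∷ zs) ∷ M))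
                  (r-split-glue x y (toList ((w ∷ I) ⊙ J)) ((z ∷ zs) ∷ M)) ⟨
      r (((x ∷ []) ∷ w ∷ I) · toList J) ((y ∷ z ∷ zs) ∷ M) +
        r (toList (((x ∷ []) ∷ w ∷ I) ⊙ J)) ((y ∷ z ∷ zs) ∷ M) ∎
    -- All three indices with front letter `x` have a first word of at least two letters, so
    -- everything vanishes on a one-letter first word.
    conv-r x (x′ ∷ xs) I J ((y ∷ []) ∷ M) = begin
      conv (r ((x ∷ x′ ∷ xs) ∷ I)) (r (toList J)) ((y ∷ []) ∷ M)
        ≈⟨ conv-∷ (r ((x ∷ x′ ∷ xs) ∷ I)) _ _ M (r-[] ((x ∷ x′ ∷ xs) ∷ I)) ⟩
      conv (r ((x ∷ x′ ∷ xs) ∷ I) ∘ ((y ∷ []) ∷_)) (r (toList J)) M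
        ≈⟨ conv-congˡ (r (toList J)) (r-glue-split x y ((x′ ∷ xs) ∷ I)) M ⟩
      conv (λ _ → 0#) (r (toList J)) M
        ≈⟨ conv-0ˡ (r (toList J)) M ⟩
      0#
        ≈⟨ +-identityˡ _ ⟨
      0# + 0#
        ≈⟨ +-cong (r-glue-split x y ((x′ ∷ xs) ∷ (I · toList J)) M)
                  (r-glue-split x y (((x′ ∷ xs) ∷ I) ⊙ J) M) ⟨
      r (((x ∷ x′ ∷ xs) ∷ I) · toList J) ((y ∷ []) ∷ M) +
        r (toList (glue x (((x′ ∷ xs) ∷ I) ⊙ J))) ((y ∷ []) ∷ M)
        -- For `·` the letter `x` comes off by computation, but `⊙` is stuck until `I` is analysed.
        ≡⟨ cong (λ N → r (((x ∷ x′ ∷ xs) ∷ I) · toList J) ((y ∷ []) ∷ M) +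
                       r (toList N) ((y ∷ []) ∷ M))
                (nearConcat-glue x (x′ ∷ xs) I J) ⟨
      r (((x ∷ x′ ∷ xs) ∷ I) · toList J) ((y ∷ []) ∷ M) +
        r (toList (((x ∷ x′ ∷ xs) ∷ I) ⊙ J)) ((y ∷ []) ∷ M) ∎
    conv-r x (x′ ∷ xs) I J ((y ∷ z ∷ zs) ∷ M) = begin
      conv (r ((x ∷ x′ ∷ xs) ∷ I)) (r (toList J)) ((y ∷ z ∷ zs) ∷ M)
        ≈⟨ conv-∷ (r ((x ∷ x′ ∷ xs) ∷ I)) _ _ M (r-[] ((x ∷ x′ ∷ xs) ∷ I)) ⟩
      conv (r ((x ∷ x′ ∷ xs) ∷ I) ∘ ((y ∷ z ∷ zs) ∷_)) (r (toList J)) M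
        ≈⟨ conv-scaled [ y ≟ x ] (r ((x′ ∷ xs) ∷ I) ∘ ((z ∷ zs) ∷_)) (r (toList J))
             (λ N → r-glue-glue x y ((x′ ∷ xs) ∷ I) ((z ∷ zs) ∷ N)) M ⟩
      [ y ≟ x ] * conv (r ((x′ ∷ xs) ∷ I) ∘ ((z ∷ zs) ∷_)) (r (toList J)) M
        ≈⟨ *-congˡ (conv-∷ (r ((x′ ∷ xs) ∷ I)) _ _ M (r-[] ((x′ ∷ xs) ∷ I))) ⟨
      [ y ≟ x ] * conv (r ((x′ ∷ xs) ∷ I)) (r (toList J)) ((z ∷ zs) ∷ M)
        ≈⟨ *-congˡ (conv-r x′ xs I J ((z ∷ zs) ∷ M)) ⟩
      [ y ≟ x ] * (r (((x′ ∷ xs) ∷ I) · toList J) ((z ∷ zs) ∷ M) +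
                   r (toList (((x′ ∷ xs) ∷ I) ⊙ J)) ((z ∷ zs) ∷ M))
        ≈⟨ distribˡ _ _ _ ⟩
      [ y ≟ x ] * r (((x′ ∷ xs) ∷ I) · toList J) ((z ∷ zs) ∷ M) +
        [ y ≟ x ] * r (toList (((x′ ∷ xs) ∷ I) ⊙ J)) ((z ∷ zs) ∷ M)
        ≈⟨ +-cong (r-glue-glue x y ((x′ ∷ xs) ∷ (I · toList J)) ((z ∷ zs) ∷ M))
                  (r-glue-glue x y (((x′ ∷ xs) ∷ I) ⊙ J) ((z ∷ zs) ∷ M)) ⟨
      r (((x ∷ x′ ∷ xs) ∷ I) · toList J) ((y ∷ z ∷ zs) ∷ M) +
        r (toList (glue x (((x′ ∷ xs) ∷ I) ⊙ J))) ((y ∷ z ∷ zs) ∷ M)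
        ≡⟨ cong (λ N → r (((x ∷ x′ ∷ xs) ∷ I) · toList J) ((y ∷ z ∷ zs) ∷ M) +
                       r (toList N) ((y ∷ z ∷ zs) ∷ M))
                (nearConcat-glue x (x′ ∷ xs) I J) ⟨
      r (((x ∷ x′ ∷ xs) ∷ I) · toList J) ((y ∷ z ∷ zs) ∷ M) +
        r (toList (((x ∷ x′ ∷ xs) ∷ I) ⊙ J)) ((y ∷ z ∷ zs) ∷ M) ∎

corollary5p6 : ∀ {c ℓ₁ ℓ₂ a} (K : HeytingField c ℓ₁ ℓ₂) → CharacteristicZero K →
    {A : Set a} {n : ℕ} (finite : A ↔ Fin n) →
    let open ColouredSymmetricFunctions K finite in
    (R : Sentence → NSym) → IsRibbonFamily R →
    (I J : NonEmptySentence) →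
    R (toList I) ⊠ R (toList J) ≈ R (toList I · toList J) ⊞ R (toList (I ⊙ J))
-- Equality in `NSym` is tested at each sentence `L`, where `⊠` becomes `conv` and `⊞` a sum in the
-- field.
corollary5p6 K _ finite R ribbon ((x ∷ xs) ∷ I) J L =
  trans (coefficient-⊠ (R ((x ∷ xs) ∷ I)) (R (toList J)) L)
    (trans (conv-r R ribbon x xs I J L)
      (sym (coefficient-++ (R _) (R _) L)))
  where
  open HeytingField K using (trans; sym)
  open RibbonProduct K finite
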